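{- There is a $1/k$-approximation algorithm for the HardMHV problem, where $k$ is the number of colors. That is, there is a polynomial-time algorithm which, on every HardMHV instance, outputs a total vertex coloring extending the given partial coloring whose number of happy vertices is at least $\frac1k\cdot OPT$, where $OPT$ is the maximum number of happy vertices over all total colorings extending the given partial coloring.
   Context: HardMHV problem (Maximum Happy Vertices with hard threshold): an instance consists of a connected undirected graph $G=(V,E)$, a color set $C=\{1,2,\ldots,k\}$, a partial vertex coloring $c\colon V\to C$ (i.e. $c$ assigns colors to only part of the vertices), and an integer $q>0$, where it is assumed that $q\le\Delta$ with $\Delta$ the maximum degree of $G$. Under a total coloring $c'\colon V\to C$, a vertex $v$ is happy if at least $q$ of its neighbors have the same color as $v$. The task is to find a total coloring extending $c$ (agreeing with $c$ wherever $c$ is defined) that maximizes the number of happy vertices. -}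

module Defs where

open import Data.Bool using (Bool; true; false)
open import Data.Fin using (Fin; zero; suc; toℕ; _≟_)
open import Data.Fin.Properties using (all?)
open import Data.List as List using (List; []; _∷_; length; filter; allFin; cartesianProductWith)
open import Data.List.Extrema.Nat using (max; xs≤max; argmax-sel)
open import Data.List.Membership.Propositional using (_∈_)
open import Data.List.Membership.Propositional.Properties
  using (∈-map⁺; ∈-map⁻; ∈-filter⁺; ∈-filter⁻; ∈-allFin; ∈-cartesianProductWith⁺)
import Data.List.Relation.Unary.All as ListAll
open import Data.List.Relation.Unary.Any using (here)
open import Data.Maybe using (Maybe; just; nothing; fromMaybe)
open import Data.Maybe.Relation.Unary.All as MaybeAll using (just; nothing)
open import Data.Nat using (ℕ; zero; suc; NonZero; _+_; _≤_; _≤?_)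
open import Data.Nat.Binary using (ℕᵇ; zero; 2[1+_]; 1+[2_]; fromℕ)
open import Data.Nat.Properties using (n≤0⇒n≡0; ≤-trans; ≤-reflexive)
open import Data.Product using (_×_; _,_; ∃-syntax)
open import Data.Sum using (inj₁; inj₂)
open import Data.Vec as Vec using (Vec; []; _∷_; lookup; replicate; _[_]≔_)
open import Data.Vec.Properties using (lookup-map)
open import Level using (0ℓ)
open import Relation.Binary using (Rel; Decidable; Symmetric; Irreflexive)
open import Relation.Binary.Construct.Closure.ReflexiveTransitive using (Star)
open import Relation.Binary.PropositionalEquality using (_≡_; refl; sym; trans; subst)
open import Relation.Nullary using (does; _×-dec_)
import Relation.Unary as Unary

------------------------------------------------------------------------
-- The HardMHV problem

count : ∀ {n} {P : Unary.Pred (Fin n) 0ℓ} → Unary.Decidable P → ℕ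
count {n} P? = length (filter P? (allFin n))

record Graph (n : ℕ) : Set₁ where
  field
    _~_    : Rel (Fin n) 0ℓ
    _~?_   : Decidable _~_
    ~-sym  : Symmetric _~_
    ~-irr  : Irreflexive _≡_ _~_

  degree : Fin n → ℕ
  degree v = count (v ~?_)

  Δ : ℕ
  Δ = max 0 (List.map degree (allFin n))

  Connected : Set
  Connected = ∀ u v → Star _~_ u v

-- The colours 1, …, k are represented by Fin k.
Coloring PartialColoring : ℕ → ℕ → Set
Coloring        n k = Vec (Fin k) n
PartialColoring n k = Vec (Maybe (Fin k)) n

module _ {n k : ℕ} where

  -- MaybeAll.All Q m: if m is just i, then Q i.
  _Extends_ : Coloring n k → PartialColoring n k → Set
  c′ Extends c = ∀ v → MaybeAll.All (lookup c′ v ≡_) (lookup c v)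

  _extends?_ : Decidable _Extends_
  c′ extends? c = all? λ v → MaybeAll.dec (lookup c′ v ≟_) (lookup c v)

colorings : ∀ n k → List (Coloring n k)
colorings zero    k = [] ∷ []
colorings (suc n) k = cartesianProductWith _∷_ (allFin k) (colorings n k)

record HardMHV : Set₁ where
  field
    n         : ℕ
    graph     : Graph n
    connected : Graph.Connected graph
    k         : ℕ
    {{k>0}}   : NonZero k
    c         : PartialColoring n k
    q         : ℕ
    {{q>0}}   : NonZero q
    q≤Δ       : q ≤ Graph.Δ graph

  open Graph graph public

  sameColorNeighbors : Coloring n k → Fin n → ℕ
  sameColorNeighbors c′ v =
    count λ u → (v ~? u) ×-dec (lookup c′ u ≟ lookup c′ v)

  Happy : Coloring n k → Fin n → Set
  Happy c′ v = q ≤ sameColorNeighbors c′ v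

  happy? : ∀ c′ → Unary.Decidable (Happy c′)
  happy? c′ v = q ≤? sameColorNeighbors c′ v

  #happy : Coloring n k → ℕ
  #happy c′ = count (happy? c′)

  extensions : List (Coloring n k)
  extensions = filter (_extends? c) (colorings n k)

  OPT : ℕ
  OPT = max 0 (List.map #happy extensions)

-- OPT is the maximum of #happy over the (non-empty) set of extensions.

∈-colorings : ∀ {n k} (c′ : Coloring n k) → c′ ∈ colorings n k
∈-colorings []       = here refl
∈-colorings (i ∷ c′) = ∈-cartesianProductWith⁺ _∷_ (∈-allFin i) (∈-colorings c′)

extension : ∀ {n k} → NonZero k → (c : PartialColoring n k) → ∃[ c′ ] c′ Extends c
extension {n} {suc k} _ c = Vec.map (fromMaybe zero) c , λ v →
  subst (λ i → MaybeAll.All (i ≡_) (lookup c v))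
        (sym (lookup-map v (fromMaybe zero) c)) (agrees (lookup c v))
  where
  agrees : (m : Maybe (Fin (suc k))) → MaybeAll.All (fromMaybe zero m ≡_) m
  agrees (just _) = just refl
  agrees nothing  = nothing

module _ (I : HardMHV) where
  open HardMHV I

  #happy≤OPT : ∀ c′ → c′ Extends c → #happy c′ ≤ OPT
  #happy≤OPT c′ ext = ListAll.lookup (xs≤max 0 (List.map #happy extensions))
    (∈-map⁺ #happy (∈-filter⁺ (_extends? c) (∈-colorings c′) ext))

  OPT-attained : ∃[ c′ ] c′ Extends c × #happy c′ ≡ OPT
  OPT-attained with argmax-sel (λ m → m) 0 (List.map #happy extensions)
  ... | inj₁ OPT≡0 =
    let c′ , ext = extension k>0 c in
    c′ , ext , trans (n≤0⇒n≡0 (≤-trans (#happy≤OPT c′ ext) (≤-reflexive OPT≡0))) (sym OPT≡0)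
  ... | inj₂ OPT∈ with ∈-map⁻ #happy OPT∈
  ...   | c′ , c′∈ , OPT≡ with ∈-filter⁻ (_extends? c) {xs = colorings n k} c′∈
  ...     | _ , ext = c′ , ext , sym OPT≡

------------------------------------------------------------------------
-- Model of computation: Jones's WHILE language over binary trees, with the
-- cost measure of "Computability and Complexity from a Programming
-- Perspective" (1997).  Its polynomial time is that of Turing machines: with
-- trees stored as pointers into a shared heap, every operation takes O(1) steps.

infixr 6 _∙_
data Tree : Set where
  nil : Tree
  _∙_ : Tree → Tree → Tree

size : Tree → ℕ
size nil     = 1
size (s ∙ t) = 1 + size s + size t

head tail : Tree → Tree
head nil     = nil
head (s ∙ t) = s
tail nil     = nil
tail (s ∙ t) = t

data Expr (m : ℕ) : Set where
  var   : Fin m → Expr m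
  nil   : Expr m
  cons  : Expr m → Expr m → Expr m
  hd tl : Expr m → Expr m

infix  5 _≔_
infixr 4 _⨾_
data Cmd (m : ℕ) : Set where
  _≔_           : Fin m → Expr m → Cmd m
  _⨾_           : Cmd m → Cmd m → Cmd m
  if_then_else_ : Expr m → Cmd m → Cmd m → Cmd m
  while_loop_     : Expr m → Cmd m → Cmd m

Store : ℕ → Set
Store = Vec Tree

module _ {m : ℕ} where

  eval : Expr m → Store m → Tree
  eval (var x)    σ = lookup σ x
  eval nil        σ = nil
  eval (cons e f) σ = eval e σ ∙ eval f σ
  eval (hd e)     σ = head (eval e σ)
  eval (tl e)     σ = tail (eval e σ)

  cost : Expr m → ℕ
  cost (var x)    = 1
  cost nil        = 1
  cost (cons e f) = 1 + cost e + cost f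
  cost (hd e)     = 1 + cost e
  cost (tl e)     = 1 + cost e

  -- C ⊢ σ ⇒ τ [ t ]: run from store σ, the command C halts in store τ after
  -- time t.  A test succeeds unless its value is nil.
  infix 3 _⊢_⇒_[_]
  data _⊢_⇒_[_] : Cmd m → Store m → Store m → ℕ → Set where

    assign : ∀ {x e σ} →
      x ≔ e ⊢ σ ⇒ σ [ x ]≔ eval e σ [ 1 + cost e ]

    seq : ∀ {C D σ τ υ s t} →
      C ⊢ σ ⇒ τ [ s ] → D ⊢ τ ⇒ υ [ t ] →
      C ⨾ D ⊢ σ ⇒ υ [ s + t ]

    if-true : ∀ {e C D σ τ u v t} → eval e σ ≡ u ∙ v →
      C ⊢ σ ⇒ τ [ t ] →
      if e then C else D ⊢ σ ⇒ τ [ 1 + cost e + t ]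

    if-false : ∀ {e C D σ τ t} → eval e σ ≡ nil →
      D ⊢ σ ⇒ τ [ t ] →
      if e then C else D ⊢ σ ⇒ τ [ 1 + cost e + t ]

    while-true : ∀ {e C σ τ υ u v s t} → eval e σ ≡ u ∙ v →
      C ⊢ σ ⇒ τ [ s ] → while e loop C ⊢ τ ⇒ υ [ t ] →
      while e loop C ⊢ σ ⇒ υ [ 1 + cost e + s + t ]

    while-false : ∀ {e C σ} → eval e σ ≡ nil →
      while e loop C ⊢ σ ⇒ σ [ 1 + cost e ]

-- Input and output are in variable 0; all other variables are initially nil.
record Program : Set where
  field
    {auxiliaries} : ℕ
    body          : Cmd (suc auxiliaries)

_on_outputs_inTime_ : Program → Tree → Tree → ℕ → Set
P on input outputs output inTime t =
  ∃[ σ ] body ⊢ input ∷ replicate auxiliaries nil ⇒ output ∷ σ [ t ]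
  where open Program P

------------------------------------------------------------------------
-- Encodings

encodeList : ∀ {A : Set} → (A → Tree) → List A → Tree
encodeList enc []       = nil
encodeList enc (x ∷ xs) = enc x ∙ encodeList enc xs

encodeBool : Bool → Tree
encodeBool false = nil
encodeBool true  = nil ∙ nil

encodeMaybe : ∀ {A : Set} → (A → Tree) → Maybe A → Tree
encodeMaybe enc nothing  = nil
encodeMaybe enc (just x) = nil ∙ enc x

encodeUnary : ℕ → Tree
encodeUnary zero    = nil
encodeUnary (suc m) = nil ∙ encodeUnary m

-- The list of (bijective base 2) digits, least significant first, so that
-- encodeBinary (fromℕ m) has size O(log m).
encodeBinary : ℕᵇ → Tree
encodeBinary zero     = nil
encodeBinary 2[1+ b ] = encodeBool false ∙ encodeBinary b
encodeBinary 1+[2 b ] = encodeBool true  ∙ encodeBinary b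

encodeColor : ∀ {k} → Fin k → Tree
encodeColor i = encodeBinary (fromℕ (toℕ i))

encodeColoring : ∀ {n k} → Coloring n k → Tree
encodeColoring c′ = encodeList encodeColor (Vec.toList c′)

-- The graph is given by its adjacency matrix.  Since q ≤ Δ < n, writing q in
-- unary does not affect the order of magnitude of the size.
encodeInstance : HardMHV → Tree
encodeInstance I =
  encodeList (λ v → encodeList (λ u → encodeBool (does (v ~? u))) (allFin n)) (allFin n)
  ∙ encodeBinary (fromℕ k)
  ∙ encodeList (encodeMaybe encodeColor) (Vec.toList c)
  ∙ encodeUnary q
  where open HardMHV I

{-# OPTIONS --safe #-}
module Submission where

-- For a candidate color i, give i to all uncolored vertices.  The algorithm tries
-- the color 0 and every color used by the partial coloring c, and keeps the candidate with
-- the most happy vertices; the number k, which is given in binary and may be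
-- exponential in the size of the input, is never read.
-- Let c* be an optimal coloring.  Vertices which c* makes happy in color i have
-- at least q neighbors in color i, and all these vertices stay equally colored if
-- everything uncolored receives i (or any other color, when c does not use i).  So each
-- of the k color classes contains at most as many happy vertices as the best candidate.

open import Defs
open import Data.Bool using (Bool; true; false; T; _∧_)
import Data.Bool.Properties as Bool
open import Data.Fin using (Fin; zero; suc; toℕ; fromℕ<; _≟_; #_)
open import Data.Fin.Properties using (toℕ-injective; toℕ<n; toℕ-fromℕ<; any?)
open import Data.Integer using (+_)
import Data.Integer as ℤ
import Data.Integer.Properties as ℤ
open import Data.List as List using (List; []; _∷_; length; filter; allFin; foldl; foldr; reverse)
import Data.List.Properties as List
open import Data.List.Membership.Propositional using (_∈_)
open import Data.List.Relation.Binary.Sublist.Propositional using (⊆-refl)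
open import Data.List.Relation.Binary.Sublist.Propositional.Properties using (filter⁺; length-mono-≤)
import Data.List.Relation.Unary.All as All
open import Data.List.Relation.Unary.Any using (here; there)
open import Data.Maybe using (Maybe; just; nothing; fromMaybe)
import Data.Maybe.Properties as Maybe
open import Data.Maybe.Relation.Unary.All as MaybeAll using (just; nothing)
open import Data.Nat using (ℕ; zero; suc; pred; NonZero; _+_; _*_; _∸_; _^_; _≤_; _<_; _≤?_; _⊔_; z≤n; s≤s; >-nonZero)
import Data.Nat as ℕ
open import Data.Nat.Binary using (ℕᵇ; zero; 2[1+_]; 1+[2_]; fromℕ; 0<even; 0<odd; even<even; even<odd; odd<even; odd<odd)
import Data.Nat.Binary as ℕᵇ
import Data.Nat.Binary.Properties as ℕᵇ
open import Data.Nat.Properties hiding (_≟_)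
open import Data.Product using (Σ-syntax; ∃-syntax; ∃₂; _×_; _,_; proj₁; proj₂)
import Data.Rational as ℚ
import Data.Rational.Properties as ℚ
import Data.Rational.Unnormalised as ℚᵘ
import Data.Rational.Unnormalised.Properties as ℚᵘ
open import Data.Sum using (_⊎_; inj₁; inj₂; [_,_])
open import Data.Vec as Vec using (Vec; []; _∷_; lookup; replicate; _[_]≔_)
open import Data.Vec.Membership.Propositional.Properties using (∈-lookup; ∈-toList⁺)
import Data.Vec.Properties as Vec
open import Level using (0ℓ)
open import Function using (_∘_; flip; mk⇔; Equivalence)
open import Relation.Binary.PropositionalEquality hiding ([_])
open import Relation.Nullary using (Dec; does; yes; no; contradiction; _×-dec_)
open import Relation.Nullary.Decidable using (does-⇔)
open import Relation.Unary using (Pred; Decidable)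

-- Running WHILE programs

infix 3 _⊢_⇒_within_
-- Exact times depend on the branches taken. Upper bounds do not, and they still add up under `_⨾_`.
_⊢_⇒_within_ : ∀ {m} → Cmd m → Store m → Store m → ℕ → Set
C ⊢ σ ⇒ τ within b = ∃[ t ] t ≤ b × C ⊢ σ ⇒ τ [ t ]

infixr 4 _⨾ʷ_
_⨾ʷ_ : ∀ {m} {C D : Cmd m} {σ τ υ s t} →
       C ⊢ σ ⇒ τ within s → D ⊢ τ ⇒ υ within t → C ⨾ D ⊢ σ ⇒ υ within s + t
(_ , s≤ , c) ⨾ʷ (_ , t≤ , d) = _ , +-mono-≤ s≤ t≤ , seq c d

branch : ∀ {A : Set} → Tree → A → A → A
branch nil     x y = y
branch (_ ∙ _) x y = x

module _ {m : ℕ} where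

  loopFree : Cmd m → Bool
  loopFree (_ ≔ _)                = true
  loopFree (C ⨾ D)                = loopFree C ∧ loopFree D
  loopFree (if e then C else D)   = loopFree C ∧ loopFree D
  loopFree (while e loop C)       = false

  run : Cmd m → Store m → Store m
  run (x ≔ e)              σ = σ [ x ]≔ eval e σ
  run (C ⨾ D)              σ = run D (run C σ)
  run (if e then C else D) σ = branch (eval e σ) (run C σ) (run D σ)
  -- Junk: run is only used on loop-free commands.
  run (while e loop C)     σ = σ

  maxTime : Cmd m → ℕ
  maxTime (x ≔ e)              = 1 + cost e
  maxTime (C ⨾ D)              = maxTime C + maxTime D
  maxTime (if e then C else D) = 1 + cost e + (maxTime C ⊔ maxTime D)
  maxTime (while e loop C)     = 0

  run-correct : ∀ C σ → loopFree C ≡ true → C ⊢ σ ⇒ run C σ within maxTime C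
  run-correct (x ≔ e) σ _ = _ , ≤-refl , assign
  run-correct (C ⨾ D) σ p with loopFree C in l
  ... | true = run-correct C σ l ⨾ʷ run-correct D (run C σ) p
  run-correct (if e then C else D) σ p with loopFree C in l | eval e σ in v
  ... | true | nil =
    let _ , t≤ , d = run-correct D σ p in
    _ , +-monoʳ-≤ (1 + cost e) (≤-trans t≤ (m≤n⊔m (maxTime C) _)) , if-false v d
  ... | true | _ ∙ _ =
    let _ , t≤ , c = run-correct C σ l in
    _ , +-monoʳ-≤ (1 + cost e) (≤-trans t≤ (m≤m⊔n _ (maxTime D))) , if-true v c

  -- For a concrete loop-free `C` the implicit argument is solved by eta, and `run` computes on a
  -- store of known shape. Verifying such a fragment thus mostly reduces to `refl`.
  exec : ∀ {C : Cmd m} {σ τ} {p : T (loopFree C)} → run C σ ≡ τ → C ⊢ σ ⇒ τ within maxTime C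
  exec {C} {σ} {p = p} refl = run-correct C σ (Equivalence.to Bool.T-≡ p)

  loopTime : Expr m → ℕ → ℕ → ℕ
  loopTime e b l = l * (1 + cost e + b) + (1 + cost e)

  -- Each loop of the program consumes a list held in the store, so it performs a left fold;
  -- `store s xs` is the invariant, with accumulator `s` and unread part `xs`. Bounding the length
  -- by a free `l` makes the time a function of a common size bound.
  while-foldl : ∀ {A S : Set} {e : Expr m} {C} (store : S → List A → Store m) (f : S → A → S) {b} →
    (∀ s x xs → ∃₂ λ u v → eval e (store s (x ∷ xs)) ≡ u ∙ v) →
    (∀ s → eval e (store s []) ≡ nil) →
    (∀ s x xs → C ⊢ store s (x ∷ xs) ⇒ store (f s x) xs within b) →
    ∀ {l} s xs → length xs ≤ l →
    while e loop C ⊢ store s xs ⇒ store (foldl f s xs) [] within loopTime e b l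
  while-foldl {e = e} store f {b} more done body {l} s [] _ =
    _ , m≤n+m (1 + cost e) (l * (1 + cost e + b)) , while-false (done s)
  while-foldl {e = e} store f {b} more done body {suc l} s (x ∷ xs) (s≤s xs≤l) =
    let u , v , uv    = more s x xs
        t , t≤b , c   = body s x xs
        t′ , t′≤ , cs = while-foldl store f more done body (f s x) xs xs≤l
    in _ , ≤-trans (+-mono-≤ (+-monoʳ-≤ (1 + cost e) t≤b) t′≤)
                   (≤-reflexive (sym (+-assoc (1 + cost e + b) (l * (1 + cost e + b)) (1 + cost e))))
         , while-true uv c cs

-- Polynomial bounds

-- A single monomial suffices as bound: for 1 ≤ N it absorbs all terms of lower degree.
record PolyBounded (d : ℕ) (f : ℕ → ℕ) : Set where
  constructor bounded
  field
    coefficient : ℕ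
    bound       : ∀ N → 1 ≤ N → f N ≤ coefficient * N ^ d

const-poly : ∀ d a → PolyBounded d (λ _ → a)
const-poly d a = bounded a λ N 1≤N →
  ≤-trans (≤-reflexive (sym (*-identityʳ a))) (*-monoʳ-≤ a (m^n>0 N {{>-nonZero 1≤N}} d))

+-poly : ∀ {d f g} → PolyBounded d f → PolyBounded d g → PolyBounded d (λ N → f N + g N)
+-poly {d} (bounded a f≤) (bounded b g≤) = bounded (a + b) λ N 1≤N →
  ≤-trans (+-mono-≤ (f≤ N 1≤N) (g≤ N 1≤N)) (≤-reflexive (sym (*-distribʳ-+ (N ^ d) a b)))

N*-poly : ∀ {d f} → PolyBounded d f → PolyBounded (suc d) (λ N → N * f N)
N*-poly {d} (bounded a f≤) = bounded a λ N 1≤N → ≤-trans (*-monoʳ-≤ N (f≤ N 1≤N)) (≤-reflexive (begin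
  N * (a * N ^ d) ≡⟨ *-assoc N a (N ^ d) ⟨
  N * a * N ^ d   ≡⟨ cong (_* N ^ d) (*-comm N a) ⟩
  a * N * N ^ d   ≡⟨ *-assoc a N (N ^ d) ⟩
  a * (N * N ^ d) ∎))
  where open ≡-Reasoning

loopTime-poly : ∀ {m} {d f} (e : Expr m) → PolyBounded d f →
                PolyBounded (suc d) (λ N → loopTime e (f N) N)
loopTime-poly {d = d} e p =
  +-poly (N*-poly (+-poly (const-poly d (1 + cost e)) p)) (const-poly (suc d) (1 + cost e))

-- Encodings

encodeList-map : ∀ {A B : Set} (enc : B → Tree) (f : A → B) xs →
                 encodeList enc (List.map f xs) ≡ encodeList (enc ∘ f) xs
encodeList-map enc f []       = refl
encodeList-map enc f (x ∷ xs) = cong (enc (f x) ∙_) (encodeList-map enc f xs)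

toList-lookup : ∀ {A : Set} {n} (xs : Vec A n) → Vec.toList xs ≡ List.map (lookup xs) (allFin n)
toList-lookup []       = refl
toList-lookup {n = suc n} (x ∷ xs) = cong (x ∷_)
  (trans (toList-lookup xs) (trans (List.map-tabulate (λ i → i) (lookup xs))
                                   (sym (List.map-tabulate suc (lookup (x ∷ xs))))))

encodeColoring-lookup : ∀ {n k} (c′ : Coloring n k) →
  encodeColoring c′ ≡ encodeList (encodeColor ∘ lookup c′) (allFin n)
encodeColoring-lookup {n} c′ = trans (cong (encodeList encodeColor) (toList-lookup c′))
                                     (encodeList-map encodeColor (lookup c′) (allFin n))

length<size : ∀ {A : Set} (enc : A → Tree) xs → length xs < size (encodeList enc xs)
length<size enc []       = s≤s z≤n
length<size enc (x ∷ xs) = s≤s (≤-trans (length<size enc xs) (m≤n+m _ (size (enc x))))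

digits : ℕᵇ → List Bool
digits zero     = []
digits 2[1+ b ] = false ∷ digits b
digits 1+[2 b ] = true ∷ digits b

encodeBinary-digits : ∀ b → encodeBinary b ≡ encodeList encodeBool (digits b)
encodeBinary-digits zero     = refl
encodeBinary-digits 2[1+ b ] = cong (nil ∙_) (encodeBinary-digits b)
encodeBinary-digits 1+[2 b ] = cong ((nil ∙ nil) ∙_) (encodeBinary-digits b)

digits-injective : ∀ {a b} → digits a ≡ digits b → a ≡ b
digits-injective {zero}     {zero}     _  = refl
digits-injective {2[1+ a ]} {2[1+ b ]} eq = cong 2[1+_] (digits-injective (List.∷-injectiveʳ eq))
digits-injective {1+[2 a ]} {1+[2 b ]} eq = cong 1+[2_] (digits-injective (List.∷-injectiveʳ eq))

-- In bijective base 2 a smaller number never has more digits. This bounds the length of every color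
-- code by that of k.
length-digits-mono : ∀ {a b} → a ℕᵇ.< b → length (digits a) ≤ length (digits b)
length-digits-mono 0<even              = z≤n
length-digits-mono 0<odd               = z≤n
length-digits-mono (even<even p)       = s≤s (length-digits-mono p)
length-digits-mono (even<odd p)        = s≤s (length-digits-mono p)
length-digits-mono (odd<even (inj₁ p)) = s≤s (length-digits-mono p)
length-digits-mono (odd<even (inj₂ e)) = s≤s (≤-reflexive (cong (length ∘ digits) e))
length-digits-mono (odd<odd p)         = s≤s (length-digits-mono p)

colorDigits : ∀ {k} → Fin k → List Bool
colorDigits i = digits (fromℕ (toℕ i))

encodeColor-digits : ∀ {k} (i : Fin k) → encodeColor i ≡ encodeList encodeBool (colorDigits i)
encodeColor-digits i = encodeBinary-digits (fromℕ (toℕ i))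

colorDigits-injective : ∀ {k} {i j : Fin k} → colorDigits i ≡ colorDigits j → i ≡ j
colorDigits-injective eq = toℕ-injective (ℕᵇ.fromℕ-injective (digits-injective eq))

length-colorDigits : ∀ {k} (i : Fin k) → length (colorDigits i) ≤ length (digits (fromℕ k))
length-colorDigits i = length-digits-mono (ℕᵇ.fromℕ-mono-< (toℕ<n i))

_≟ᵈ_ : (xs ys : List Bool) → Dec (xs ≡ ys)
_≟ᵈ_ = List.≡-dec Bool._≟_

tail-unary : ∀ m n → tail (encodeUnary (m ∸ n)) ≡ encodeUnary (m ∸ suc n)
tail-unary m n = trans (lemma (m ∸ n)) (cong encodeUnary (pred[m∸n]≡m∸[1+n] m n))
  where
  lemma : ∀ d → tail (encodeUnary d) ≡ encodeUnary (pred d)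
  lemma zero    = refl
  lemma (suc d) = refl

-- The program compares numbers only by testing whether a countdown has become nil.
does-≤? : ∀ m n → does (m ≤? n) ≡ does (m ∸ n ℕ.≟ 0)
does-≤? m n = does-⇔ (mk⇔ m≤n⇒m∸n≡0 m∸n≡0⇒m≤n) (m ≤? n) (m ∸ n ℕ.≟ 0)

-- Counting

tally : Bool → ℕ → ℕ
tally true  a = suc a
tally false a = a

foldl-tally : ∀ {A : Set} {P : Pred A 0ℓ} (P? : Decidable P) a xs →
  foldl (λ a x → tally (does (P? x)) a) a xs ≡ a + length (filter P? xs)
foldl-tally P? a [] = sym (+-identityʳ a)
foldl-tally P? a (x ∷ xs) with does (P? x)
... | true  = trans (foldl-tally P? (suc a) xs) (sym (+-suc a _))
... | false = foldl-tally P? a xs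

-- Used with Q for happy under the optimal coloring, P for membership in one color class, and R for
-- happy under a candidate.
length-filter-filter : ∀ {A : Set} {P Q R : Pred A 0ℓ} (P? : Decidable P) (Q? : Decidable Q) (R? : Decidable R) →
  (∀ {x} → P x → Q x → R x) → ∀ xs → length (filter P? (filter Q? xs)) ≤ length (filter R? xs)
length-filter-filter P? Q? R? imp [] = z≤n
length-filter-filter P? Q? R? imp (x ∷ xs) with Q? x
length-filter-filter P? Q? R? imp (x ∷ xs) | no _ with does (R? x)
... | true  = m≤n⇒m≤1+n (length-filter-filter P? Q? R? imp xs)
... | false = length-filter-filter P? Q? R? imp xs
length-filter-filter P? Q? R? imp (x ∷ xs) | yes qx with P? x | R? x
... | yes px | no ¬rx = contradiction (imp px qx) ¬rx
... | yes _  | yes _  = s≤s (length-filter-filter P? Q? R? imp xs)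
... | no _   | yes _  = m≤n⇒m≤1+n (length-filter-filter P? Q? R? imp xs)
... | no _   | no _   = length-filter-filter P? Q? R? imp xs

length-filter-∪ : ∀ {A : Set} {P Q R : Pred A 0ℓ} (P? : Decidable P) (Q? : Decidable Q) (R? : Decidable R) →
  (∀ {x} → P x → Q x ⊎ R x) → ∀ xs → length (filter P? xs) ≤ length (filter Q? xs) + length (filter R? xs)
length-filter-∪ P? Q? R? P⊆Q∪R [] = z≤n
length-filter-∪ P? Q? R? P⊆Q∪R (x ∷ xs) with length-filter-∪ P? Q? R? P⊆Q∪R xs | P? x | Q? x | R? x
... | ih | yes _  | yes _ | yes _  = s≤s (≤-trans ih (+-monoʳ-≤ _ (n≤1+n _)))
... | ih | yes _  | yes _ | no _   = s≤s ih
... | ih | yes _  | no _  | yes _  = ≤-trans (s≤s ih) (≤-reflexive (sym (+-suc _ _)))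
... | ih | yes px | no ¬q | no ¬r  = contradiction (P⊆Q∪R px) [ ¬q , ¬r ]
... | ih | no _   | yes _ | yes _  = m≤n⇒m≤1+n (≤-trans ih (+-monoʳ-≤ _ (n≤1+n _)))
... | ih | no _   | yes _ | no _   = m≤n⇒m≤1+n ih
... | ih | no _   | no _  | yes _  = ≤-trans ih (+-monoʳ-≤ _ (n≤1+n _))
... | ih | no _   | no _  | no _   = ih

-- The factor k of the approximation arises here: the classes are added one at a time, by induction
-- on the number j of classes covered.
length-by-classes : ∀ {A : Set} {k b} (f : A → Fin k) xs →
  (∀ i → length (filter (λ x → f x ≟ i) xs) ≤ b) → length xs ≤ k * b
length-by-classes {k = k} {b} f xs class≤b =
  ≤-trans (≤-reflexive (cong length (sym (List.filter-all (below? k) (All.universal (λ x → toℕ<n (f x)) xs)))))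
          (length-below k ≤-refl)
  where
  below? : ∀ j → Decidable (λ x → toℕ (f x) < j)
  below? j x = toℕ (f x) ℕ.<? j
  length-below : ∀ j → j ≤ k → length (filter (below? j) xs) ≤ j * b
  length-below zero    _   = ≤-reflexive (cong length (List.filter-none (below? 0) (All.universal (λ _ ()) xs)))
  length-below (suc j) j<k = ≤-trans
    (length-filter-∪ (below? (suc j)) (λ x → f x ≟ fromℕ< j<k) (below? j)
      (λ x<1+j → [ inj₂ , (λ x≡j → inj₁ (toℕ-injective (trans x≡j (sym (toℕ-fromℕ< j<k))))) ] (m<1+n⇒m<n∨m≡n x<1+j)) xs)
    (+-mono-≤ (class≤b (fromℕ< j<k)) (length-below j (<⇒≤ j<k)))

-- The algorithm

-- Named fields let invariants be written as record updates, while `⟦_⟧` yields a literal vector on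
-- which `run` reduces even for an abstract memory.
record Memory : Set where
  field
    io adjacency threshold reversed candidates best bestCount candidate coloring work
      rows owns happies margin row others quota x y equal : Tree

⟦_⟧ : Memory → Store 20
⟦ μ ⟧ = io ∷ adjacency ∷ threshold ∷ reversed ∷ candidates ∷ best ∷ bestCount ∷ candidate ∷ coloring ∷ work ∷
        rows ∷ owns ∷ happies ∷ margin ∷ row ∷ others ∷ quota ∷ x ∷ y ∷ equal ∷ []
  where open Memory μ

io adjacency threshold reversed candidates best bestCount candidate coloring work
  rows owns happies margin row others quota x y equal : Fin 20
io         = # 0
adjacency  = # 1
threshold  = # 2
reversed   = # 3
candidates = # 4
best       = # 5
bestCount  = # 6
candidate  = # 7
coloring   = # 8
work       = # 9
rows       = # 10
owns       = # 11
happies    = # 12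
margin     = # 13
row        = # 14
others     = # 15
quota      = # 16
x          = # 17
y          = # 18
equal      = # 19

infix 5 push_onto_ pop_
push_onto_ : Expr 20 → Fin 20 → Cmd 20
push e onto v = v ≔ cons e (var v)

pop_ : Fin 20 → Cmd 20
pop v = v ≔ tl (var v)

skip : Cmd 20
skip = io ≔ var io

-- `equal` is never set here, only cleared. Started with the adjacency bit, it ends as the
-- conjunction of adjacency and equality of colors.
compareDigit compareEnd compare : Cmd 20
compareDigit =
  (if var y
    then (if hd (var x)
      then (if hd (var y) then skip else (equal ≔ nil))
      else (if hd (var y) then (equal ≔ nil) else skip))
    else (equal ≔ nil)) ⨾
  pop x ⨾ pop y
compareEnd =
  (if var y then (equal ≔ nil) else skip) ⨾
  y ≔ nil
compare = while var x loop compareDigit ⨾ compareEnd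

-- quota and margin count down from q and from the best count so far.  As tail nil = nil,
-- they are nil exactly when the respective number has been reached or exceeded.
countStart countEnd countNeighbor : Cmd 20
countStart    = x ≔ hd (var others) ⨾ y ≔ hd (var owns) ⨾ equal ≔ hd (var row)
countEnd      = (if var equal then (pop quota) else skip) ⨾ pop row ⨾ pop others ⨾ equal ≔ nil
countNeighbor = countStart ⨾ compare ⨾ countEnd

-- `rows` and `owns` advance once per vertex, `row` and `others` once per potential neighbor; the
-- head of `owns` stays the color of the current vertex meanwhile.
vertexStart vertexEnd countVertex : Cmd 20
vertexStart = row ≔ hd (var rows) ⨾ others ≔ var coloring ⨾ quota ≔ var threshold
vertexEnd   =
  (if var quota then skip else (push nil onto happies ⨾ pop margin)) ⨾
  quota ≔ nil ⨾ others ≔ nil ⨾ pop rows ⨾ pop owns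
countVertex = vertexStart ⨾ while var row loop countNeighbor ⨾ vertexEnd

happyStart countHappy : Cmd 20
happyStart = rows ≔ var adjacency ⨾ owns ≔ var coloring ⨾ happies ≔ nil ⨾ margin ≔ var bestCount
countHappy = happyStart ⨾ while var rows loop countVertex

-- Pushing reverses the order, so the partial coloring is read from a reversed copy that is computed
-- once.
fillStart fillVertex fill : Cmd 20
fillStart  = coloring ≔ nil ⨾ work ≔ var reversed
fillVertex =
  (if hd (var work)
    then (push tl (hd (var work)) onto coloring)
    else (push var candidate onto coloring)) ⨾
  pop work
fill = fillStart ⨾ while var work loop fillVertex

tryStart tryEnd tryCandidate : Cmd 20
tryStart     = candidate ≔ tl (hd (var candidates)) ⨾ pop candidates
tryEnd       =
  -- A nil `margin` means at least as many happy vertices as the best so far; ties go to the newer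
  -- candidate. The variables cleared afterwards restore the loop invariant.
  (if var margin then skip else (best ≔ var candidate ⨾ bestCount ≔ var happies)) ⨾
  owns ≔ nil ⨾ happies ≔ nil ⨾ margin ≔ nil ⨾ coloring ≔ nil ⨾ candidate ≔ nil
tryCandidate = tryStart ⨾ fill ⨾ countHappy ⨾ tryEnd

unpack reverseStep algorithm : Cmd 20
unpack      =
  adjacency ≔ hd (var io) ⨾ work ≔ hd (tl (tl (var io))) ⨾
  -- The entries of c serve as candidates directly. The extra nil in front, like every uncolored
  -- entry, has tail nil, which is the code of color 0.
  threshold ≔ tl (tl (tl (var io))) ⨾ candidates ≔ cons nil (var work)
reverseStep = push hd (var work) onto reversed ⨾ pop work
algorithm   =
  unpack ⨾
  while var work loop reverseStep ⨾
  while var candidates loop tryCandidate ⨾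
  -- Only the best color has been kept, so its coloring is built once more.
  candidate ≔ var best ⨾
  fill ⨾
  io ≔ var coloring

-- Correctness of the algorithm

compareTime neighborTime vertexTime happyTime fillTime tryTime algorithmTime : ℕ → ℕ
compareTime   N = loopTime (var x) (maxTime compareDigit) N + maxTime compareEnd
neighborTime  N = maxTime countStart + (compareTime N + maxTime countEnd)
vertexTime    N = maxTime vertexStart + (loopTime (var row) (neighborTime N) N + maxTime vertexEnd)
happyTime     N = maxTime happyStart + loopTime (var rows) (vertexTime N) N
fillTime      N = maxTime fillStart + loopTime (var work) (maxTime fillVertex) N
tryTime       N = maxTime tryStart + (fillTime N + (happyTime N + maxTime tryEnd))
algorithmTime N =
  maxTime unpack + (loopTime (var work) (maxTime reverseStep) N +
  -- Each 2 is the cost of one assignment from a variable.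
  (loopTime (var candidates) (tryTime N) N + (2 + (fillTime N + 2))))

-- The degree is the nesting depth of the loops: candidates, vertices, neighbors, digits.
algorithmTime-poly : PolyBounded 4 algorithmTime
algorithmTime-poly =
  +-poly (const-poly 4 (maxTime unpack)) (+-poly (loopTime-poly (var work) (const-poly 3 (maxTime reverseStep)))
    (+-poly (loopTime-poly (var candidates) try)
      (+-poly (const-poly 4 2) (+-poly (fill-poly 3) (const-poly 4 2)))))
  where
  fill-poly : ∀ d → PolyBounded (suc d) fillTime
  fill-poly d = +-poly (const-poly (suc d) (maxTime fillStart))
                       (loopTime-poly (var work) (const-poly d (maxTime fillVertex)))
  compare-poly : PolyBounded 1 compareTime
  compare-poly = +-poly (loopTime-poly (var x) (const-poly 0 (maxTime compareDigit)))
                        (const-poly 1 (maxTime compareEnd))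
  neighbor : PolyBounded 1 neighborTime
  neighbor = +-poly (const-poly 1 (maxTime countStart))
                    (+-poly compare-poly (const-poly 1 (maxTime countEnd)))
  vertex : PolyBounded 2 vertexTime
  vertex = +-poly (const-poly 2 (maxTime vertexStart))
                  (+-poly (loopTime-poly (var row) neighbor) (const-poly 2 (maxTime vertexEnd)))
  happy : PolyBounded 3 happyTime
  happy = +-poly (const-poly 3 (maxTime happyStart)) (loopTime-poly (var rows) vertex)
  try : PolyBounded 3 tryTime
  try = +-poly (const-poly 3 (maxTime tryStart))
               (+-poly (fill-poly 2) (+-poly happy (const-poly 3 (maxTime tryEnd))))

-- Comparing two colors

compareState : Memory → List Bool × Bool → List Bool → Store 20
compareState μ (ys , b) xs =
  ⟦ record μ { x = encodeList encodeBool xs ; y = encodeList encodeBool ys ; equal = encodeBool b } ⟧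

compareStep : List Bool × Bool → Bool → List Bool × Bool
compareStep ([]     , b) x = [] , false
compareStep (y ∷ ys , b) x = ys , b ∧ does (x Bool.≟ y)

compareResult : List Bool × Bool → Bool
compareResult ([]     , b) = b
compareResult (_ ∷ _ , b) = false

-- The initial flag is arbitrary, both for the induction and because it is later the adjacency bit.
foldl-compare : ∀ xs ys b → compareResult (foldl compareStep (ys , b) xs) ≡ b ∧ does (xs ≟ᵈ ys)
foldl-compare []       []       b = sym (Bool.∧-identityʳ b)
foldl-compare []       (y ∷ ys) b = sym (Bool.∧-zeroʳ b)
foldl-compare (x ∷ xs) []       b = trans (lemma xs) (sym (Bool.∧-zeroʳ b))
  where
  lemma : ∀ xs → compareResult (foldl compareStep ([] , false) xs) ≡ false
  lemma []       = refl
  lemma (_ ∷ xs) = lemma xs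
foldl-compare (x ∷ xs) (y ∷ ys) b = trans (foldl-compare xs ys _) (Bool.∧-assoc b _ _)

compare-correct : ∀ {N} μ b xs ys → length xs ≤ N →
  compare ⊢ compareState μ (ys , b) xs ⇒
    ⟦ record μ { x = nil ; y = nil ; equal = encodeBool (b ∧ does (xs ≟ᵈ ys)) } ⟧ within compareTime N
compare-correct μ b xs ys xs≤N =
  while-foldl (compareState μ) compareStep more (λ _ → refl) body (ys , b) xs xs≤N ⨾ʷ
  subst (λ z → compareEnd ⊢ compareState μ final [] ⇒ ⟦ record μ { x = nil ; y = nil ; equal = encodeBool z } ⟧ within maxTime compareEnd)
    (foldl-compare xs ys b) (end final)
  where
  final : List Bool × Bool
  final = foldl compareStep (ys , b) xs
  more : ∀ s z zs → ∃₂ λ u v → eval (var x) (compareState μ s (z ∷ zs)) ≡ u ∙ v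
  more s x xs = _ , _ , refl
  body : ∀ s x xs → compareDigit ⊢ compareState μ s (x ∷ xs) ⇒ compareState μ (compareStep s x) xs within maxTime compareDigit
  -- The cases fix every tested bit, so that each conditional computes.
  body ([] , b)         x     xs = exec refl
  body (true ∷ ys , true)   true  xs = exec refl
  body (true ∷ ys , true)   false xs = exec refl
  body (false ∷ ys , true)  true  xs = exec refl
  body (false ∷ ys , true)  false xs = exec refl
  body (true ∷ ys , false)  true  xs = exec refl
  body (true ∷ ys , false)  false xs = exec refl
  body (false ∷ ys , false) true  xs = exec refl
  body (false ∷ ys , false) false xs = exec refl
  end : ∀ s → compareEnd ⊢ compareState μ s [] ⇒ ⟦ record μ { x = nil ; y = nil ; equal = encodeBool (compareResult s) } ⟧ within maxTime compareEnd
  end ([]    , b) = exec refl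
  end (_ ∷ _ , b) = exec refl

-- Filling the uncolored vertices

module _ {k : ℕ} where

  encodePartial : List (Maybe (Fin k)) → Tree
  encodePartial = encodeList (encodeMaybe encodeColor)

  fillState : Memory → List (Fin k) → List (Maybe (Fin k)) → Store 20
  fillState μ is ms = ⟦ record μ { coloring = encodeList encodeColor is ; work = encodePartial ms } ⟧

  fill-correct : ∀ {N} μ (i : Fin k) ms → length ms ≤ N →
    fill ⊢ ⟦ record μ { candidate = encodeColor i ; reversed = encodePartial (reverse ms) } ⟧ ⇒
      ⟦ record μ { candidate = encodeColor i ; reversed = encodePartial (reverse ms)
                 ; coloring = encodeList encodeColor (List.map (fromMaybe i) ms) ; work = nil } ⟧
      within fillTime N
  fill-correct μ₀ i ms ms≤N = exec refl ⨾ʷ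
    subst (λ is → while var work loop fillVertex ⊢ fillState μ [] (reverse ms) ⇒ fillState μ is [] within _)
      -- A left fold over the reversal is a right fold over the original list, and this one is a
      -- map.
      (trans (List.reverse-foldl (λ is m → fromMaybe i m ∷ is) [] ms) (lemma ms))
      (while-foldl (fillState μ) (λ is m → fromMaybe i m ∷ is) (λ _ _ _ → _ , _ , refl) (λ _ → refl) body
        [] (reverse ms) (≤-trans (≤-reflexive (List.length-reverse ms)) ms≤N))
    where
    μ : Memory
    μ = record μ₀ { candidate = encodeColor i ; reversed = encodePartial (reverse ms) }
    body : ∀ is m ms → fillVertex ⊢ fillState μ is (m ∷ ms) ⇒ fillState μ (fromMaybe i m ∷ is) ms
                         within maxTime fillVertex
    body is nothing  ms = exec refl
    body is (just _) ms = exec refl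
    lemma : ∀ ms → foldr (λ m is → fromMaybe i m ∷ is) [] ms ≡ List.map (fromMaybe i) ms
    lemma []       = refl
    lemma (m ∷ ms) = cong (fromMaybe i m ∷_) (lemma ms)

-- Counting happy vertices

module _ (I : HardMHV) where
  open HardMHV I

  fillWith : Fin k → Coloring n k
  fillWith i = Vec.map (fromMaybe i) c

  sameColorNeighbor? : (c′ : Coloring n k) (v u : Fin n) → Dec (v ~ u × lookup c′ u ≡ lookup c′ v)
  sameColorNeighbor? c′ v u = (v ~? u) ×-dec (lookup c′ u ≟ lookup c′ v)

  encodeColors : Coloring n k → List (Fin n) → Tree
  encodeColors c′ = encodeList (encodeColor ∘ lookup c′)

  encodeRow : Fin n → List (Fin n) → Tree
  encodeRow v = encodeList (λ u → encodeBool (does (v ~? u)))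

  encodeRows : List (Fin n) → Tree
  encodeRows = encodeList (λ v → encodeRow v (allFin n))

  module _ {N : ℕ} (n≤N : n ≤ N) (k≤N : length (digits (fromℕ k)) ≤ N) (c′ : Coloring n k) where

    neighborState : Memory → Fin n → List (Fin n) → ℕ → List (Fin n) → Store 20
    neighborState μ v vs a us = ⟦ record μ
      { row = encodeRow v us ; others = encodeColors c′ us ; owns = encodeColors c′ (v ∷ vs)
      ; quota = encodeUnary (q ∸ a) ; x = nil ; y = nil ; equal = nil } ⟧

    countNeighbor-correct : ∀ μ v vs a u us →
      countNeighbor ⊢ neighborState μ v vs a (u ∷ us) ⇒
        neighborState μ v vs (tally (does (sameColorNeighbor? c′ v u)) a) us within neighborTime N
    countNeighbor-correct μ v vs a u us =
      exec (cong₂ (λ s t → ⟦ record ν { x = s ; y = t ; equal = encodeBool (does (v ~? u)) } ⟧)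
                  (encodeColor-digits (lookup c′ u)) (encodeColor-digits (lookup c′ v))) ⨾ʷ
      subst (λ b → compare ⊢ compareState ν (colorDigits (lookup c′ v) , does (v ~? u)) (colorDigits (lookup c′ u))
                     ⇒ ⟦ record ν { equal = encodeBool (does (v ~? u) ∧ b) } ⟧ within compareTime N)
        -- Digits determine the color, so comparing codes decides equality of colors.
        (does-⇔ (mk⇔ colorDigits-injective (cong colorDigits)) (_ ≟ᵈ _) (lookup c′ u ≟ lookup c′ v))
        (compare-correct ν (does (v ~? u)) _ _ (≤-trans (length-colorDigits (lookup c′ u)) k≤N)) ⨾ʷ
      -- `does` of `_×-dec_` computes to `_∧_`, so the flag left by `compare` is this Boolean.
      end (does (sameColorNeighbor? c′ v u))
      where
      ν : Memory
      ν = record μ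
        { row = encodeRow v (u ∷ us) ; others = encodeColors c′ (u ∷ us) ; owns = encodeColors c′ (v ∷ vs)
        ; quota = encodeUnary (q ∸ a) ; x = nil ; y = nil ; equal = nil }
      end : ∀ b → countEnd ⊢ ⟦ record ν { equal = encodeBool b } ⟧ ⇒ neighborState μ v vs (tally b a) us
                    within maxTime countEnd
      end true  = exec (cong (λ t → ⟦ record ν { row = encodeRow v us ; others = encodeColors c′ us ; quota = t } ⟧)
                             (tail-unary q a))
      end false = exec refl

    module _ (b : ℕ) where

      vertexState : Memory → ℕ → List (Fin n) → Store 20
      vertexState μ a vs = ⟦ record μ
        { adjacency = encodeRows (allFin n) ; threshold = encodeUnary q ; coloring = encodeColors c′ (allFin n)
        ; rows = encodeRows vs ; owns = encodeColors c′ vs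
        ; happies = encodeUnary a ; margin = encodeUnary (b ∸ a)
        ; row = nil ; others = nil ; quota = nil ; x = nil ; y = nil ; equal = nil } ⟧

      countVertex-correct : ∀ μ a v vs →
        countVertex ⊢ vertexState μ a (v ∷ vs) ⇒ vertexState μ (tally (does (happy? c′ v)) a) vs within vertexTime N
      countVertex-correct μ a v vs =
        exec refl ⨾ʷ
        while-foldl (neighborState ν v vs) (λ a u → tally (does (sameColorNeighbor? c′ v u)) a)
          (λ _ _ _ → _ , _ , refl) (λ _ → refl) (countNeighbor-correct ν v vs)
          0 (allFin n) (≤-trans (≤-reflexive (List.length-tabulate (λ i → i))) n≤N) ⨾ʷ
        subst₂ (λ s z → vertexEnd ⊢ neighborState ν v vs s [] ⇒ vertexState μ (tally z a) vs within maxTime vertexEnd)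
          (sym (foldl-tally (sameColorNeighbor? c′ v) 0 (allFin n)))
          (sym (does-≤? q (sameColorNeighbors c′ v)))
          -- The remaining quota is generalised to an arbitrary number `d`, on which `end` can
          -- split.
          (end (q ∸ sameColorNeighbors c′ v))
        where
        ν : Memory
        ν = record μ
          { adjacency = encodeRows (allFin n) ; threshold = encodeUnary q ; coloring = encodeColors c′ (allFin n)
          ; rows = encodeRows (v ∷ vs) ; happies = encodeUnary a ; margin = encodeUnary (b ∸ a) }
        end : ∀ d → vertexEnd ⊢ ⟦ record ν { row = nil ; others = nil ; owns = encodeColors c′ (v ∷ vs)
                                           ; quota = encodeUnary d ; x = nil ; y = nil ; equal = nil } ⟧
                      ⇒ vertexState μ (tally (does (d ℕ.≟ 0)) a) vs within maxTime vertexEnd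
        end zero    = exec (cong (λ t → ⟦ record ν
          { rows = encodeRows vs ; owns = encodeColors c′ vs ; happies = encodeUnary (suc a) ; margin = t
          ; row = nil ; others = nil ; quota = nil ; x = nil ; y = nil ; equal = nil } ⟧) (tail-unary b a))
        end (suc d) = exec refl

      countHappy-correct : ∀ μ →
        let ν = record μ
              { adjacency = encodeRows (allFin n) ; threshold = encodeUnary q ; coloring = encodeColors c′ (allFin n)
              ; bestCount = encodeUnary b
              ; row = nil ; others = nil ; quota = nil ; x = nil ; y = nil ; equal = nil } in
        countHappy ⊢ ⟦ ν ⟧ ⇒
          ⟦ record ν { rows = nil ; owns = nil ; happies = encodeUnary (#happy c′)
                     ; margin = encodeUnary (b ∸ #happy c′) } ⟧ within happyTime N
      countHappy-correct μ =
        exec refl ⨾ʷ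
        subst (λ s → while var rows loop countVertex ⊢ vertexState ν 0 (allFin n) ⇒ vertexState ν s []
                       within loopTime (var rows) (vertexTime N) N)
          (foldl-tally (happy? c′) 0 (allFin n))
          (while-foldl (vertexState ν) (λ a v → tally (does (happy? c′ v)) a)
            (λ _ _ _ → _ , _ , refl) (λ _ → refl) (countVertex-correct ν)
            0 (allFin n) (≤-trans (≤-reflexive (List.length-tabulate (λ i → i))) n≤N))
        where
        ν : Memory
        ν = record μ { bestCount = encodeUnary b }

  -- Trying all candidates

  encodeColoring-fillWith : ∀ i →
    encodeList encodeColor (List.map (fromMaybe i) (Vec.toList c)) ≡ encodeColors (fillWith i) (allFin n)
  encodeColoring-fillWith i = trans (cong (encodeList encodeColor) (sym (Vec.toList-map (fromMaybe i) c)))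
                                    (encodeColoring-lookup (fillWith i))

  keepBetter : Bool → (old new : Fin k × ℕ) → Fin k × ℕ
  keepBetter true  old new = new
  keepBetter false old new = old

  -- The second component of a state records the number of happy vertices
  -- achieved by the first (it is 0 initially).
  tryStep : Fin k → Fin k × ℕ → Maybe (Fin k) → Fin k × ℕ
  tryStep i₀ (i , b) m = keepBetter (does (b ≤? #happy (fillWith j))) (i , b) (j , #happy (fillWith j))
    where
    j : Fin k
    j = fromMaybe i₀ m

  bestFill : Fin k → Fin k × ℕ
  bestFill i₀ = foldl (tryStep i₀) (i₀ , 0) (nothing ∷ Vec.toList c)

  module _ {N : ℕ} (n<N : n < N) (k≤N : length (digits (fromℕ k)) ≤ N)
           (i₀ : Fin k) (i₀-nil : encodeColor i₀ ≡ nil) where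

    private
      ms₀ : List (Maybe (Fin k))
      ms₀ = Vec.toList c

      length-ms₀ : length ms₀ ≡ n
      length-ms₀ = Vec.length-toList c

    module _ (input : Tree) where

      tryMemory : Fin k × ℕ → List (Maybe (Fin k)) → Memory
      tryMemory (i , b) ms = record
        { io = input ; adjacency = encodeRows (allFin n) ; threshold = encodeUnary q
        ; reversed = encodePartial (reverse ms₀) ; candidates = encodePartial ms
        ; best = encodeColor i ; bestCount = encodeUnary b ; candidate = nil
        ; coloring = nil ; work = nil ; rows = nil ; owns = nil ; happies = nil ; margin = nil
        ; row = nil ; others = nil ; quota = nil ; x = nil ; y = nil ; equal = nil }

      tryState : Fin k × ℕ → List (Maybe (Fin k)) → Store 20
      tryState s ms = ⟦ tryMemory s ms ⟧

      tryCandidate-correct : ∀ s m ms →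
        tryCandidate ⊢ tryState s (m ∷ ms) ⇒ tryState (tryStep i₀ s m) ms within tryTime N
      tryCandidate-correct (i , b) m ms =
        exec (cong (λ t → ⟦ record μ { candidate = t } ⟧) (candidate-code m)) ⨾ʷ
        subst (λ t → fill ⊢ ⟦ record μ { candidate = encodeColor j } ⟧
                       ⇒ ⟦ record μ { candidate = encodeColor j ; coloring = t } ⟧ within fillTime N)
          (encodeColoring-fillWith j)
          (fill-correct μ j ms₀ (≤-trans (≤-reflexive length-ms₀) (<⇒≤ n<N))) ⨾ʷ
        countHappy-correct (<⇒≤ n<N) k≤N (fillWith j) b (record μ { candidate = encodeColor j }) ⨾ʷ
        subst (λ z → tryEnd ⊢ ⟦ counted (b ∸ h) ⟧ ⇒ tryState (keepBetter z (i , b) (j , h)) ms within maxTime tryEnd)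
          (sym (does-≤? b h)) (end (b ∸ h))
        where
        j : Fin k
        j = fromMaybe i₀ m
        h : ℕ
        h = #happy (fillWith j)
        μ : Memory
        μ = tryMemory (i , b) ms
        counted : ℕ → Memory
        counted d = record μ { candidate = encodeColor j ; coloring = encodeColors (fillWith j) (allFin n)
                             ; happies = encodeUnary h ; margin = encodeUnary d }
        candidate-code : ∀ m → tail (encodeMaybe encodeColor m) ≡ encodeColor (fromMaybe i₀ m)
        candidate-code nothing  = sym i₀-nil
        candidate-code (just _) = refl
        end : ∀ d → tryEnd ⊢ ⟦ counted d ⟧ ⇒ tryState (keepBetter (does (d ℕ.≟ 0)) (i , b) (j , h)) ms
                      within maxTime tryEnd
        end zero    = exec refl
        end (suc d) = exec refl

    algorithm-correct : ∃[ σ ] algorithm ⊢ encodeInstance I ∷ replicate 19 nil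
                          ⇒ encodeColoring (fillWith (proj₁ (bestFill i₀))) ∷ σ within algorithmTime N
    algorithm-correct = _ ,
      (exec refl ⨾ʷ
       while-foldl reverseState (flip _∷_) (λ _ _ _ → _ , _ , refl) (λ _ → refl) (λ _ _ _ → exec refl)
         [] ms₀ (≤-trans (≤-reflexive length-ms₀) (<⇒≤ n<N)) ⨾ʷ
       -- The program starts with `best` equal to nil, which is read as the code of i₀.
       subst (λ t → while var candidates loop tryCandidate
                      ⊢ ⟦ record μ₀ { best = t } ⟧ ⇒ tryState input (bestFill i₀) [] within loopTime (var candidates) (tryTime N) N)
         i₀-nil
         (while-foldl (tryState input) (tryStep i₀) (λ _ _ _ → _ , _ , refl) (λ _ → refl) (tryCandidate-correct input)
           -- There are n + 1 candidates, which is why n < N is strict.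
           (i₀ , 0) (nothing ∷ ms₀) (≤-trans (≤-reflexive (cong suc length-ms₀)) n<N)) ⨾ʷ
       exec refl ⨾ʷ
       fill-correct (tryMemory input (bestFill i₀) []) i ms₀ (≤-trans (≤-reflexive length-ms₀) (<⇒≤ n<N)) ⨾ʷ
       exec (cong (λ t → ⟦ record final { io = t } ⟧)
                  (cong (encodeList encodeColor) (sym (Vec.toList-map (fromMaybe i) c)))))
      where
      input : Tree
      input = encodeInstance I
      i : Fin k
      i = proj₁ (bestFill i₀)
      μ₀ : Memory
      μ₀ = tryMemory input (i₀ , 0) (nothing ∷ ms₀)
      final : Memory
      final = record (tryMemory input (bestFill i₀) [])
        { candidate = encodeColor i ; coloring = encodeList encodeColor (List.map (fromMaybe i) ms₀) }
      reverseState : List (Maybe (Fin k)) → List (Maybe (Fin k)) → Store 20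
      reverseState done ms = ⟦ record μ₀ { best = nil ; reversed = encodePartial done ; work = encodePartial ms } ⟧

  -- The approximation ratio

  fillWith-extends : ∀ i → fillWith i Extends c
  fillWith-extends i v = subst (λ j → MaybeAll.All (j ≡_) (lookup c v)) (sym (Vec.lookup-map v (fromMaybe i) c))
                               (agrees (lookup c v))
    where
    agrees : ∀ m → MaybeAll.All (fromMaybe i m ≡_) m
    agrees (just _) = just refl
    agrees nothing  = nothing

  keepBetter-max : ∀ {i b j h} (b≤?h : Dec (b ≤ h)) → b ≤ #happy (fillWith i) → h ≤ #happy (fillWith j) →
    let (i′ , b′) = keepBetter (does b≤?h) (i , b) (j , h) in
    b ≤ b′ × h ≤ b′ × b′ ≤ #happy (fillWith i′)
  keepBetter-max (yes b≤h) _  h≤ = b≤h , ≤-refl , h≤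
  keepBetter-max (no b≰h)  b≤ _  = ≤-refl , ≰⇒≥ b≰h , b≤

  -- The invariant is an inequality because the initial count 0 may be below the number of happy
  -- vertices for i₀.
  foldl-tryStep : ∀ i₀ s ms → proj₂ s ≤ #happy (fillWith (proj₁ s)) →
    let (i′ , b′) = foldl (tryStep i₀) s ms in
    proj₂ s ≤ b′ × b′ ≤ #happy (fillWith i′) × (∀ {m} → m ∈ ms → #happy (fillWith (fromMaybe i₀ m)) ≤ b′)
  foldl-tryStep i₀ s []       b≤ = ≤-refl , b≤ , λ ()
  foldl-tryStep i₀ s (m ∷ ms) b≤ =
    let b≤₁ , h≤₁ , b₁≤ = keepBetter-max (proj₂ s ≤? #happy (fillWith (fromMaybe i₀ m))) b≤ ≤-refl
        b₁≤′ , b′≤ , all = foldl-tryStep i₀ (tryStep i₀ s m) ms b₁≤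
    in ≤-trans b≤₁ b₁≤′ , b′≤ , λ { (here refl) → ≤-trans h≤₁ b₁≤′ ; (there m∈) → all m∈ }

  bestFill-best : ∀ i₀ {m} → m ∈ nothing ∷ Vec.toList c →
    #happy (fillWith (fromMaybe i₀ m)) ≤ #happy (fillWith (proj₁ (bestFill i₀)))
  bestFill-best i₀ m∈ =
    let _ , b≤ , all = foldl-tryStep i₀ (i₀ , 0) (nothing ∷ Vec.toList c) z≤n in ≤-trans (all m∈) b≤

  -- If c uses the color i, fill with i; otherwise every vertex that c′ colors i is
  -- uncolored in c, so any single color will do.
  fill-preserves-class : ∀ i₀ c′ → c′ Extends c → ∀ i →
    ∃[ m ] m ∈ nothing ∷ Vec.toList c ×
      (∀ {v} → lookup c′ v ≡ i → lookup (fillWith (fromMaybe i₀ m)) v ≡ fromMaybe i₀ m)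
  fill-preserves-class i₀ c′ ext i with any? (λ v → Maybe.≡-dec _≟_ (lookup c v) (just i))
  ... | yes (w , cw) = just i , there (subst (_∈ Vec.toList c) cw (∈-toList⁺ (∈-lookup w c))) , λ {v} c′v →
    trans (Vec.lookup-map v (fromMaybe i) c) (lemma (lookup c v) (ext v) c′v)
    where
    lemma : ∀ {j} m → MaybeAll.All (j ≡_) m → j ≡ i → fromMaybe i m ≡ i
    lemma nothing  _           _   = refl
    lemma (just _) (just refl) j≡i = j≡i
  ... | no unused = nothing , here refl , λ {v} c′v →
    trans (Vec.lookup-map v (fromMaybe i₀) c) (lemma v (lookup c v) refl (ext v) c′v)
    where
    lemma : ∀ {j} v m → lookup c v ≡ m → MaybeAll.All (j ≡_) m → j ≡ i → fromMaybe i₀ m ≡ i₀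
    lemma v nothing  _  _           _    = refl
    lemma v (just _) cv (just refl) refl = contradiction (v , cv) unused

  -- A vertex v of the class and its neighbors of the same color all lie in the class, so they agree
  -- again under c″: the same-colored neighbors of v under c′ form a sublist of those under c″.
  class-stays-happy : ∀ {c′ c″ i j} → (∀ {v} → lookup c′ v ≡ i → lookup c″ v ≡ j) →
                      ∀ {v} → lookup c′ v ≡ i → Happy c′ v → Happy c″ v
  class-stays-happy {c′} {c″} pres {v} c′v happy = ≤-trans happy
    (length-mono-≤ (filter⁺ (sameColorNeighbor? c′ v) (sameColorNeighbor? c″ v)
      (λ { refl (v~u , eq) → v~u , trans (pres (trans eq c′v)) (sym (pres c′v)) }) (⊆-refl {x = allFin n})))

  #happy≤k*bestFill : ∀ i₀ c′ → c′ Extends c → #happy c′ ≤ k * #happy (fillWith (proj₁ (bestFill i₀)))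
  -- The happy vertices are classified by their color under c′; the candidate may differ from class
  -- to class, but `bestFill` beats each.
  #happy≤k*bestFill i₀ c′ ext = length-by-classes (lookup c′) (filter (happy? c′) (allFin n)) λ i →
    let m , m∈ , pres = fill-preserves-class i₀ c′ ext i
        c″            = fillWith (fromMaybe i₀ m)
    in ≤-trans (length-filter-filter (λ v → lookup c′ v ≟ i) (happy? c′) (happy? c″)
                  (class-stays-happy {c′} {c″} pres) (allFin n))
               (bestFill-best i₀ m∈)

  OPT≤k*bestFill : ∀ i₀ → OPT ≤ k * #happy (fillWith (proj₁ (bestFill i₀)))
  OPT≤k*bestFill i₀ =
    let c* , ext , happy≡OPT = OPT-attained I
    in ≤-trans (≤-reflexive (sym happy≡OPT)) (#happy≤k*bestFill i₀ c* ext)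

  -- Instance size and the final bound

  n<size : n < size (encodeInstance I)
  n<size = ≤-trans (subst (_< size (encodeRows (allFin n))) (List.length-tabulate (λ i → i))
                          (length<size (λ v → encodeRow v (allFin n)) (allFin n)))
                   (≤-trans (m≤m+n _ _) (n≤1+n _))

  -- The code of k is a subtree of the input; with `length-colorDigits` this bounds every comparison
  -- of colors.
  digits-k≤size : length (digits (fromℕ k)) ≤ size (encodeInstance I)
  digits-k≤size = begin
    length (digits (fromℕ k))                          <⟨ length<size encodeBool (digits (fromℕ k)) ⟩
    size (encodeList encodeBool (digits (fromℕ k)))    ≡⟨ cong size (encodeBinary-digits (fromℕ k)) ⟨
    size (encodeBinary (fromℕ k))                      ≤⟨ m≤m+n _ _ ⟩
    size (encodeBinary (fromℕ k)) + _                  ≤⟨ n≤1+n _ ⟩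
    suc (size (encodeBinary (fromℕ k)) + _)            ≤⟨ m≤n+m _ (suc (size (encodeRows (allFin n)))) ⟩
    size (encodeInstance I)                            ∎
    where open ≤-Reasoning

-- Color 0 exists as k is nonzero; its nil code makes it the default that the program obtains for
-- free.
nilColor : ∀ k → NonZero k → ∃[ i ] encodeColor {k} i ≡ nil
nilColor (suc k) _ = zero , refl

ratio : ∀ k {{_ : NonZero k}} {opt h} → opt ≤ k * h → (+ 1 ℚ./ k) ℚ.* (+ opt ℚ./ 1) ℚ.≤ (+ h ℚ./ 1)
ratio (suc k) {opt} {h} opt≤ = ℚ.toℚᵘ-cancel-≤ (begin
  ℚ.toℚᵘ ((+ 1 ℚ./ suc k) ℚ.* (+ opt ℚ./ 1))
    ≃⟨ ℚ.toℚᵘ-homo-* (+ 1 ℚ./ suc k) (+ opt ℚ./ 1) ⟩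
  ℚ.toℚᵘ (+ 1 ℚ./ suc k) ℚᵘ.* ℚ.toℚᵘ (+ opt ℚ./ 1)
    ≃⟨ ℚᵘ.*-cong (ℚ.toℚᵘ-fromℚᵘ (ℚᵘ.mkℚᵘ (+ 1) k)) (ℚ.toℚᵘ-fromℚᵘ (ℚᵘ.mkℚᵘ (+ opt) 0)) ⟩
  -- `mkℚᵘ` takes the denominator minus one, so the first factor is 1/(k + 1). In this unnormalised
  -- form the inequality is a cross-multiplication of integers.
  ℚᵘ.mkℚᵘ (+ 1) k ℚᵘ.* ℚᵘ.mkℚᵘ (+ opt) 0
    ≤⟨ ℚᵘ.*≤* (subst₂ ℤ._≤_ lhs rhs (ℤ.+≤+ opt≤)) ⟩
  ℚᵘ.mkℚᵘ (+ h) 0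
    ≃⟨ ℚ.toℚᵘ-fromℚᵘ (ℚᵘ.mkℚᵘ (+ h) 0) ⟨
  ℚ.toℚᵘ (+ h ℚ./ 1) ∎)
  where
  open ℚᵘ.≤-Reasoning
  lhs : + opt ≡ + 1 ℤ.* + opt ℤ.* + 1
  lhs = sym (trans (ℤ.*-identityʳ (+ 1 ℤ.* + opt)) (ℤ.*-identityˡ (+ opt)))
  rhs : + (suc k * h) ≡ + h ℤ.* + (suc k * 1)
  rhs = trans (cong +_ (trans (*-comm (suc k) h) (cong (h *_) (sym (*-identityʳ (suc k)))))) (ℤ.pos-* h (suc k * 1))

theoremC1 : Σ[ P ∈ Program ] Σ[ a ∈ ℕ ] Σ[ d ∈ ℕ ] ((I : HardMHV) → let open HardMHV I in
    Σ[ c′ ∈ Coloring n k ] Σ[ t ∈ ℕ ]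
    (P on encodeInstance I outputs encodeColoring c′ inTime t)
    × t ≤ a * size (encodeInstance I) ^ d
    × c′ Extends c
    × (+ 1 ℚ./ k) ℚ.* (+ OPT ℚ./ 1) ℚ.≤ (+ #happy c′ ℚ./ 1))
theoremC1 = record { body = algorithm } , PolyBounded.coefficient algorithmTime-poly , 4 , λ I →
  let open HardMHV I
      i₀ , i₀-nil        = nilColor k k>0
      -- All loop bounds are instantiated with N equal to the size of the encoded instance.
      σ , t , t≤ , steps = algorithm-correct I (n<size I) (digits-k≤size I) i₀ i₀-nil
  in fillWith I (proj₁ (bestFill I i₀)) , t , (σ , steps)
   , ≤-trans t≤ (PolyBounded.bound algorithmTime-poly (size (encodeInstance I)) (s≤s z≤n))
   , fillWith-extends I _
   , ratio k (OPT≤k*bestFill I i₀)
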